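{- Let $\mathsf{G},\mathsf{G}'$ be well-formed global types with $\mathrm{pt}(\mathsf{G})\cap\mathrm{pt}(\mathsf{G}')=\emptyset$ and $\mathsf{G}\!\upharpoonright\!\mathsf{h}\leftrightarrow\mathsf{G}'\!\upharpoonright\!\mathsf{k}$. Then for every call in the tree of recursive calls of $\mathrm{cn}(\mathsf{h},\mathsf{k},\#,\mathsf{G},\mathsf{G}')$: (a) if the call is $\mathrm{cn}(\mathsf{h},\mathsf{k},\#,\mathsf{Y},\mathsf{Y}')$, then $\mathsf{Y}\!\upharpoonright\!\mathsf{h}\leftrightarrow\mathsf{Y}'\!\upharpoonright\!\mathsf{k}$; (b) if the call is $\mathrm{cn}(\mathsf{h},\mathsf{k},\ell^{\to},\mathsf{Y},\mathsf{Y}')$, then $\mathsf{p}?\ell.(\mathsf{Y}\!\upharpoonright\!\mathsf{h})\leftrightarrow\mathsf{Y}'\!\upharpoonright\!\mathsf{k}$ for some participant $\mathsf{p}$; (c) if the call is $\mathrm{cn}(\mathsf{h},\mathsf{k},\ell^{\leftarrow},\mathsf{Y},\mathsf{Y}')$, then $\mathsf{Y}\!\upharpoonright\!\mathsf{h}\leftrightarrow\mathsf{p}?\ell.(\mathsf{Y}'\!\upharpoonright\!\mathsf{k})$ for some participant $\mathsf{p}$.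
   Context: Processes are possibly infinite regular trees generated coinductively by $P ::= \mathbf{0}\mid \mathsf{p}?\Lambda\mid \mathsf{p}!\Lambda$ with $\Lambda=\{\ell_1.P_1,\dots,\ell_n.P_n\}$ ($n\ge1$, distinct messages); $\mathsf{p}?\ell.P$ is a one-branch input; $\Lambda_1\oplus\Lambda_2$ a union with disjoint message sets. Compatibility $\leftrightarrow$: largest symmetric relation with $P\leftrightarrow Q$ implying either $P=Q=\mathbf{0}$, or one is $\mathsf{p}!(\{\ell_i.P_i\}_{i\le n}\oplus\Lambda)$ and the other $\mathsf{q}?\{\ell_i.Q_i\}_{i\le n}$ (arbitrary $\mathsf{p},\mathsf{q}$) with $P_i\leftrightarrow Q_i$. Global types: regular trees generated coinductively by $\mathsf{G}::=\mathtt{end}\mid\mathsf{p}\to\mathsf{q}:\{\ell_i.\mathsf{G}_i\}_{i\le n}$ (distinct messages); $\mathsf{p}\to\mathsf{q}:\ell.\mathsf{G}$ is one branch; $\mathrm{pt}(\mathsf{G})$ its participants. Projection (partial, coinductive): $\mathsf{G}\!\upharpoonright\!\mathsf{p}=\mathbf{0}$ if $\mathsf{p}\notin\mathrm{pt}(\mathsf{G})$; $(\mathsf{p}\to\mathsf{q}:\{\ell_i.\mathsf{G}_i\})\!\upharpoonright\!\mathsf{p}=\mathsf{q}!\{\ell_i.(\mathsf{G}_i\!\upharpoonright\!\mathsf{p})\}$; $(\mathsf{q}\to\mathsf{p}:\{\ell_i.\mathsf{G}_i\})\!\upharpoonright\!\mathsf{p}=\mathsf{q}?\{\ell_i.(\mathsf{G}_i\!\upharpoonright\!\mathsf{p})\}$;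 for $\mathsf{p}\notin\{\mathsf{q},\mathsf{r}\}$, $(\mathsf{q}\to\mathsf{r}:\{\ell_i.\mathsf{G}_i\}_{i\le n})\!\upharpoonright\!\mathsf{p}$ is $\mathsf{G}_1\!\upharpoonright\!\mathsf{p}$ if all $\mathsf{G}_i\!\upharpoonright\!\mathsf{p}$ coincide, is $\mathsf{s}?(\Lambda_1\oplus\cdots\oplus\Lambda_n)$ if each $\mathsf{G}_i\!\upharpoonright\!\mathsf{p}=\mathsf{s}?\Lambda_i$ with pairwise disjoint label sets, undefined otherwise. Well formed: every participant has finite weight (supremum over root paths of the number of communications before the first one involving it; the path length, possibly $\infty$, if none) and defined projection. $\mathrm{cn}(\mathsf{h},\mathsf{k},\star,\mathsf{G},\mathsf{G}')$, $\star\in\{\#,\ell^{\to},\ell^{\leftarrow}\}$, is defined coinductively by the first applicable clause, with $\mathsf{p},\mathsf{q},\mathsf{r},\mathsf{s}\notin\{\mathsf{h},\mathsf{k}\}$ (the current first two arguments): (1) $\mathrm{cn}(\mathsf{h},\mathsf{k},\#,\mathtt{end},\mathsf{G}')=\mathsf{G}'$; (2) $\mathrm{cn}(\mathsf{h},\mathsf{k},\#,\mathsf{p}\to\mathsf{h}:\{\ell_i.\mathsf{G}_i\},\mathsf{G}')=\mathsf{p}\to\mathsf{h}:\{\ell_i.\mathrm{cn}(\mathsf{h},\mathsf{k},\ell_i^{\to},\mathsf{G}_i,\mathsf{G}')\}$; (3) $\mathrm{cn}(\mathsf{h},\mathsf{k},\ell^{\to},\mathsf{G},\mathsf{k}\to\mathsf{s}:\{\ell'_j.\mathsf{G}'_j\})=\mathsf{h}\to\mathsf{k}:\ell.\,\mathsf{k}\to\mathsf{s}:\ell.\,\mathrm{cn}(\mathsf{h},\mathsf{k},\#,\mathsf{G},\mathsf{G}'_\iota)$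 if $\ell=\ell'_\iota$; (4) $\mathrm{cn}(\mathsf{h},\mathsf{k},\ell^{\to},\mathsf{G},\mathsf{r}\to\mathsf{s}:\{\ell'_j.\mathsf{G}'_j\})=\mathsf{r}\to\mathsf{s}:\{\ell'_j.\mathrm{cn}(\mathsf{h},\mathsf{k},\ell^{\to},\mathsf{G},\mathsf{G}'_j)\}$; (5) $\mathrm{cn}(\mathsf{h},\mathsf{k},\#,\mathsf{G},\mathsf{r}\to\mathsf{k}:\{\ell'_j.\mathsf{G}'_j\})=\mathsf{r}\to\mathsf{k}:\{\ell'_j.\mathrm{cn}(\mathsf{h},\mathsf{k},{\ell'_j}^{\leftarrow},\mathsf{G},\mathsf{G}'_j)\}$; (6) $\mathrm{cn}(\mathsf{h},\mathsf{k},\ell^{\leftarrow},\mathsf{h}\to\mathsf{q}:\{\ell_i.\mathsf{G}_i\},\mathsf{G}')=\mathsf{k}\to\mathsf{h}:\ell.\,\mathsf{h}\to\mathsf{q}:\ell.\,\mathrm{cn}(\mathsf{h},\mathsf{k},\#,\mathsf{G}_\iota,\mathsf{G}')$ if $\ell=\ell_\iota$; (7) $\mathrm{cn}(\mathsf{h},\mathsf{k},\ell^{\leftarrow},\mathsf{p}\to\mathsf{q}:\{\ell_i.\mathsf{G}_i\},\mathsf{G}')=\mathsf{p}\to\mathsf{q}:\{\ell_i.\mathrm{cn}(\mathsf{h},\mathsf{k},\ell^{\leftarrow},\mathsf{G}_i,\mathsf{G}')\}$; (8) $\mathrm{cn}(\mathsf{h},\mathsf{k},\#,\mathsf{p}\to\mathsf{q}:\{\ell_i.\mathsf{G}_i\},\mathsf{G}')=\mathsf{p}\to\mathsf{q}:\{\ell_i.\mathrm{cn}(\mathsf{k},\mathsf{h},\#,\mathsf{G}',\mathsf{G}_i)\}$;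 (9) $\mathrm{cn}(\mathsf{h},\mathsf{k},\#,\mathsf{G},\mathsf{r}\to\mathsf{s}:\{\ell'_j.\mathsf{G}'_j\})=\mathsf{r}\to\mathsf{s}:\{\ell'_j.\mathrm{cn}(\mathsf{k},\mathsf{h},\#,\mathsf{G}'_j,\mathsf{G})\}$. The tree of recursive calls of $\mathrm{cn}(\mathsf{h},\mathsf{k},\#,\mathsf{G},\mathsf{G}')$ has this call as root, and the children of a call are the calls of $\mathrm{cn}$ on the right-hand side of the clause applied to it. -}

module Defs where

open import Data.Nat using (ℕ; zero; suc)
open import Data.Fin as Fin using (Fin)
open import Data.Product using (Σ; ∃; ∃-syntax; _×_; _,_; proj₁; proj₂; map₂)
open import Data.Sum using (_⊎_)
open import Data.Empty using (⊥)
open import Data.Unit using (⊤)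
open import Data.List as List using (List; []; _∷_)
open import Data.List.NonEmpty as List⁺ using (List⁺; toList; [_])
open import Data.List.Membership.Propositional using (_∈_)
open import Data.List.Relation.Unary.All using (All)
open import Data.List.Relation.Unary.AllPairs using (AllPairs)
open import Data.List.Relation.Unary.Unique.Propositional using (Unique)
open import Data.List.Relation.Binary.Pointwise using (Pointwise)
open import Relation.Nullary using (¬_)
open import Relation.Binary.PropositionalEquality using (_≡_; _≢_)
open import Relation.Binary.Construct.Closure.ReflexiveTransitive using (Star)

Role : Set
Role = ℕ

Label : Set
Label = ℕ

-- A regular tree is presented by a finite graph together with a root node;
-- the tree is the unfolding of the graph from the root.  (Coinductive
-- records are not available: --guardedness is not allowed here.)
-- All notions below (projection, compatibility, tree equality, …) are
-- defined through the unfolding, i.e. via `view`, and are invariant under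
-- the choice of presenting graph.

data PNode (n : ℕ) : Set where
  nil : PNode n
  inp : Role → List⁺ (Label × Fin n) → PNode n
  out : Role → List⁺ (Label × Fin n) → PNode n

record PGraph : Set where
  field
    psize : ℕ
    pnode : Fin psize → PNode psize
open PGraph public

record Proc : Set where
  constructor ⟨_,_⟩ₚ
  field
    pgraph : PGraph
    proot  : Fin (psize pgraph)
open Proc public

data PShape : Set where
  nil : PShape
  inp : Role → List⁺ (Label × Proc) → PShape
  out : Role → List⁺ (Label × Proc) → PShape

viewP : Proc → PShape
viewP ⟨ g , v ⟩ₚ with pnode g v
... | nil      = nil
... | inp p Λ  = inp p (List⁺.map (map₂ (λ i → ⟨ g , i ⟩ₚ)) Λ)
... | out p Λ  = out p (List⁺.map (map₂ (λ i → ⟨ g , i ⟩ₚ)) Λ)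

shiftP : ∀ {n} → PNode n → PNode (suc n)
shiftP nil       = nil
shiftP (inp p Λ) = inp p (List⁺.map (map₂ Fin.suc) Λ)
shiftP (out p Λ) = out p (List⁺.map (map₂ Fin.suc) Λ)

inp1 : Role → Label → Proc → Proc
inp1 p ℓ ⟨ g , v ⟩ₚ = ⟨ g' , Fin.zero ⟩ₚ
  where
  nd : Fin (suc (psize g)) → PNode (suc (psize g))
  nd Fin.zero    = inp p [ ℓ , Fin.suc v ]
  nd (Fin.suc i) = shiftP (pnode g i)
  g' : PGraph
  g' = record { psize = suc (psize g) ; pnode = nd }

labelsP : List⁺ (Label × Proc) → List Label
labelsP Λ = List.map proj₁ (toList Λ)

-- equality of process trees: bisimilarity of the unfoldings
-- (branch sets compared as sets)
BisimStepP : (Proc → Proc → Set) → PShape → PShape → Set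
BisimStepP R nil       nil       = ⊤
BisimStepP R (inp p Λ) (inp q Λ') =
  p ≡ q ×
  (∀ {ℓ P} → (ℓ , P) ∈ toList Λ  → ∃[ Q ] ((ℓ , Q) ∈ toList Λ' × R P Q)) ×
  (∀ {ℓ Q} → (ℓ , Q) ∈ toList Λ' → ∃[ P ] ((ℓ , P) ∈ toList Λ  × R P Q))
BisimStepP R (out p Λ) (out q Λ') =
  p ≡ q ×
  (∀ {ℓ P} → (ℓ , P) ∈ toList Λ  → ∃[ Q ] ((ℓ , Q) ∈ toList Λ' × R P Q)) ×
  (∀ {ℓ Q} → (ℓ , Q) ∈ toList Λ' → ∃[ P ] ((ℓ , P) ∈ toList Λ  × R P Q))
BisimStepP R _ _ = ⊥

_≈P_ : Proc → Proc → Set₁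
P ≈P Q = ∃[ R ] ((∀ {P' Q'} → R P' Q' → BisimStepP R (viewP P') (viewP Q')) × R P Q)

_≈Λ_ : List (Label × Proc) → List (Label × Proc) → Set₁
Λ ≈Λ Λ' =
  (∀ {ℓ P} → (ℓ , P) ∈ Λ  → ∃[ Q ] ((ℓ , Q) ∈ Λ' × P ≈P Q)) ×
  (∀ {ℓ Q} → (ℓ , Q) ∈ Λ' → ∃[ P ] ((ℓ , P) ∈ Λ  × P ≈P Q))

OutIn : (Proc → Proc → Set) → List⁺ (Label × Proc) → List⁺ (Label × Proc) → Set
OutIn R Λo Λi = ∀ {ℓ Q'} → (ℓ , Q') ∈ toList Λi → ∃[ P' ] ((ℓ , P') ∈ toList Λo × R P' Q')

CompatStep : (Proc → Proc → Set) → PShape → PShape → Set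
CompatStep R nil       nil        = ⊤
CompatStep R (out p Λo) (inp q Λi) = OutIn R Λo Λi
CompatStep R (inp q Λi) (out p Λo) = OutIn R Λo Λi
CompatStep R _ _ = ⊥

_↔_ : Proc → Proc → Set₁
P ↔ Q = ∃[ R ] ((∀ {P' Q'} → R P' Q' → R Q' P') ×
                (∀ {P' Q'} → R P' Q' → CompatStep R (viewP P') (viewP Q')) ×
                R P Q)

data GNode (n : ℕ) : Set where
  end : GNode n
  msg : Role → Role → List⁺ (Label × Fin n) → GNode n

record GGraph : Set where
  field
    gsize : ℕ
    gnode : Fin gsize → GNode gsize
open GGraph public

record Global : Set where
  constructor ⟨_,_⟩
  field
    ggraph : GGraph
    groot  : Fin (gsize ggraph)
open Global public

data GShape : Set where
  end : GShape
  msg : Role → Role → List⁺ (Label × Global) → GShape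

view : Global → GShape
view ⟨ g , v ⟩ with gnode g v
... | end        = end
... | msg p q bs = msg p q (List⁺.map (map₂ (λ i → ⟨ g , i ⟩)) bs)

labelsG : List⁺ (Label × Global) → List Label
labelsG bs = List.map proj₁ (toList bs)

data _∈pt_ (p : Role) (G : Global) : Set where
  here  : ∀ {q r bs} → view G ≡ msg q r bs → (p ≡ q ⊎ p ≡ r) → p ∈pt G
  there : ∀ {q r bs ℓ G'} → view G ≡ msg q r bs → (ℓ , G') ∈ toList bs →
          p ∈pt G' → p ∈pt G

data Sub (G : Global) : Global → Set where
  sub-refl : Sub G G
  sub-step : ∀ {H q r bs ℓ H'} → view H ≡ msg q r bs → (ℓ , H') ∈ toList bs →
             Sub G H' → Sub G H

DistinctMsgs : Global → Set
DistinctMsgs G = ∀ H → Sub H G → ∀ {q r bs} → view H ≡ msg q r bs → Unique (labelsG bs)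

-- Weight: Weight≤ n G p holds iff on every path from the root there are
-- at most n communications before the first one involving p (or, if the
-- path has none involving p, the path has length at most n).

data Weight≤ : ℕ → Global → Role → Set where
  w-end  : ∀ {n G p} → view G ≡ end → Weight≤ n G p
  w-here : ∀ {n G p q r bs} → view G ≡ msg q r bs → (p ≡ q ⊎ p ≡ r) → Weight≤ n G p
  w-step : ∀ {n G p q r bs} → view G ≡ msg q r bs → p ≢ q → p ≢ r →
           (∀ {ℓ G'} → (ℓ , G') ∈ toList bs → Weight≤ n G' p) →
           Weight≤ (suc n) G p

-- Projection, coinductive: G ↾ p = P iff (G,p,P) belongs to some relation R
-- that is closed under the defining clauses (a post-fixpoint).

PRel : Set₁
PRel = Global → Role → Proc → Set

BranchProj : PRel → Role → List⁺ (Label × Global) → List⁺ (Label × Proc) → Set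
BranchProj R p bs Λ =
  (∀ {ℓ G'} → (ℓ , G') ∈ toList bs → ∃[ P' ] ((ℓ , P') ∈ toList Λ × R G' p P')) ×
  (∀ {ℓ P'} → (ℓ , P') ∈ toList Λ → ∃[ G' ] ((ℓ , G') ∈ toList bs × R G' p P'))

DisjointLabels : List⁺ (Label × Proc) → List⁺ (Label × Proc) → Set
DisjointLabels Λ Λ' = ∀ {ℓ} → ℓ ∈ labelsP Λ → ℓ ∈ labelsP Λ' → ⊥

data ProjStep (R : PRel) (G : Global) (p : Role) (P : Proc) : Set₁ where
  proj-none  : ¬ (p ∈pt G) → viewP P ≡ nil → ProjStep R G p P
  proj-send  : ∀ {q bs Λ} → view G ≡ msg p q bs → viewP P ≡ out q Λ →
               BranchProj R p bs Λ → ProjStep R G p P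
  proj-recv  : ∀ {q bs Λ} → view G ≡ msg q p bs → viewP P ≡ inp q Λ →
               BranchProj R p bs Λ → ProjStep R G p P
  proj-same  : ∀ {q r bs} → p ∈pt G → view G ≡ msg q r bs → p ≢ q → p ≢ r →
               All (λ b → R (proj₂ b) p P) (toList bs) → ProjStep R G p P
  proj-merge : ∀ {q r bs s Λ} (Λs : List (List⁺ (Label × Proc))) →
               p ∈pt G → view G ≡ msg q r bs → p ≢ q → p ≢ r →
               viewP P ≡ inp s Λ →
               Pointwise (λ b Λᵢ → ∃[ Pᵢ ] (R (proj₂ b) p Pᵢ × viewP Pᵢ ≡ inp s Λᵢ))
                         (toList bs) Λs →
               AllPairs DisjointLabels Λs →
               toList Λ ≈Λ List.concatMap toList Λs →
               ProjStep R G p P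

Proj : Global → Role → Proc → Set₁
Proj G p P = ∃[ R ] ((∀ {G' p' P'} → R G' p' P' → ProjStep R G' p' P') × R G p P)

ProjDefined : Global → Role → Set₁
ProjDefined G p = ∃[ P ] Proj G p P

-- well-formed global type (including the syntactic constraint of global
-- types: distinct messages in every choice; regularity is built into the
-- finite-graph representation)
WellFormed : Global → Set₁
WellFormed G =
  DistinctMsgs G ×
  (∀ p → p ∈pt G → ∃[ n ] Weight≤ n G p) ×
  (∀ p → ProjDefined G p)

data Mode : Set where
  #  : Mode
  ⟶_ : Label → Mode
  ⟵_ : Label → Mode

record Call : Set where
  constructor cn
  field
    h k  : Role
    mode : Mode
    Y Y' : Global
open Call public

Outside : Role → Role → Role → Set
Outside h k p = p ≢ h × p ≢ k

Clause2 : Role → Role → Global → Set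
Clause2 h k G = ∃[ p ] ∃[ bs ] (view G ≡ msg p h bs × Outside h k p)

Clause5 : Role → Role → Global → Set
Clause5 h k G' = ∃[ r ] ∃[ bs ] (view G' ≡ msg r k bs × Outside h k r)

Clause8 : Role → Role → Global → Set
Clause8 h k G = ∃[ p ] ∃[ q ] ∃[ bs ] (view G ≡ msg p q bs × Outside h k p × Outside h k q)

-- Child c c' : c' is a call of cn on the right-hand side of the
-- (first applicable) clause applied to the call c.
data Child : Call → Call → Set where
  cl2 : ∀ {h k G G' p bs ℓ Gᵢ} →
        view G ≡ msg p h bs → Outside h k p → (ℓ , Gᵢ) ∈ toList bs →
        Child (cn h k # G G') (cn h k (⟶ ℓ) Gᵢ G')
  cl3 : ∀ {h k ℓ G G' s bs G'ᵢ} →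
        view G' ≡ msg k s bs → Outside h k s → (ℓ , G'ᵢ) ∈ toList bs →
        Child (cn h k (⟶ ℓ) G G') (cn h k # G G'ᵢ)
  cl4 : ∀ {h k ℓ G G' r s bs ℓ' G'ⱼ} →
        view G' ≡ msg r s bs → Outside h k r → Outside h k s → (ℓ' , G'ⱼ) ∈ toList bs →
        Child (cn h k (⟶ ℓ) G G') (cn h k (⟶ ℓ) G G'ⱼ)
  cl5 : ∀ {h k G G' r bs ℓ' G'ⱼ} →
        ¬ (view G ≡ end) → ¬ Clause2 h k G →
        view G' ≡ msg r k bs → Outside h k r → (ℓ' , G'ⱼ) ∈ toList bs →
        Child (cn h k # G G') (cn h k (⟵ ℓ') G G'ⱼ)
  cl6 : ∀ {h k ℓ G G' q bs Gᵢ} →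
        view G ≡ msg h q bs → Outside h k q → (ℓ , Gᵢ) ∈ toList bs →
        Child (cn h k (⟵ ℓ) G G') (cn h k # Gᵢ G')
  cl7 : ∀ {h k ℓ G G' p q bs ℓ' Gᵢ} →
        view G ≡ msg p q bs → Outside h k p → Outside h k q → (ℓ' , Gᵢ) ∈ toList bs →
        Child (cn h k (⟵ ℓ) G G') (cn h k (⟵ ℓ) Gᵢ G')
  cl8 : ∀ {h k G G' p q bs ℓ Gᵢ} →
        ¬ Clause5 h k G' →
        view G ≡ msg p q bs → Outside h k p → Outside h k q → (ℓ , Gᵢ) ∈ toList bs →
        Child (cn h k # G G') (cn k h # G' Gᵢ)
  cl9 : ∀ {h k G G' r s bs ℓ' G'ⱼ} →
        ¬ (view G ≡ end) → ¬ Clause2 h k G → ¬ Clause5 h k G' → ¬ Clause8 h k G →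
        view G' ≡ msg r s bs → Outside h k r → Outside h k s → (ℓ' , G'ⱼ) ∈ toList bs →
        Child (cn h k # G G') (cn k h # G'ⱼ G)

InCallTree : Call → Call → Set
InCallTree c c' = Star Child c c'

Invariant : Call → Set₁
Invariant (cn h k # Y Y') =
  ∃[ P ] ∃[ P' ] (Proj Y h P × Proj Y' k P' × P ↔ P')
Invariant (cn h k (⟶ ℓ) Y Y') =
  ∃[ p ] ∃[ P ] ∃[ P' ] (Proj Y h P × Proj Y' k P' × inp1 p ℓ P ↔ P')
Invariant (cn h k (⟵ ℓ) Y Y') =
  ∃[ p ] ∃[ P ] ∃[ P' ] (Proj Y h P × Proj Y' k P' × P ↔ inp1 p ℓ P')

-- The invariant is preserved by each clause of cn.  Clauses (2) and (5) prune
-- an input of a projection to the branch being followed, which preserves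
-- compatibility; clauses (3) and (6) follow the output branch with the chosen
-- message, which is the unique one because messages are distinct; clauses (4),
-- (7), (8), (9) enter a branch of a communication between other participants,
-- whose projection is either the whole projection or one of the inputs merged
-- into it, and both remain compatible with the same outputs.  Compatibility
-- has to be handled up to bisimilarity: the continuation of p?ℓ.P is only
-- bisimilar to P, and merging identifies branches only up to bisimilarity.
module Submission where

open import Defs
open import Data.Product using (∃-syntax; _×_; Σ; _,_; proj₁; proj₂; map₂)
open import Data.Empty using (⊥; ⊥-elim)
open import Data.Unit using (tt)
open import Data.Sum using (_⊎_; inj₁; inj₂)
open import Data.Fin as Fin using (Fin)
open import Data.List as List using (List; _∷_)
open import Data.List.NonEmpty as List⁺ using (List⁺; toList; [_])
open import Data.List.Relation.Unary.Any using (here; there)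
open import Data.List.Membership.Propositional using (_∈_)
open import Data.List.Membership.Propositional.Properties using (∈-map⁺; ∈-map⁻; ∈-concat⁺′)
open import Data.List.Relation.Unary.All as All using ()
open import Data.List.Relation.Unary.AllPairs using (_∷_)
open import Data.List.Relation.Unary.Unique.Propositional using (Unique)
open import Data.List.Relation.Unary.Unique.Propositional.Properties using (Unique[x∷xs]⇒x∉xs)
open import Data.List.Relation.Binary.Pointwise using (Pointwise; _∷_)
open import Relation.Nullary using (¬_)
open import Relation.Binary.PropositionalEquality using (_≡_; _≢_; refl; sym; trans; subst; subst₂)
open import Relation.Binary.Construct.Closure.ReflexiveTransitive using (ε; _◅_)

unique-keys-functional : ∀ {A : Set} {xs : List (Label × A)} {ℓ a b} →
  Unique (List.map proj₁ xs) → (ℓ , a) ∈ xs → (ℓ , b) ∈ xs → a ≡ b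
unique-keys-functional u (here refl) (here refl) = refl
unique-keys-functional u (here refl) (there m) = ⊥-elim (Unique[x∷xs]⇒x∉xs u (∈-map⁺ proj₁ m))
unique-keys-functional u (there m) (here refl) = ⊥-elim (Unique[x∷xs]⇒x∉xs u (∈-map⁺ proj₁ m))
unique-keys-functional (_ ∷ u) (there m) (there m') = unique-keys-functional u m m'

Pointwise-∈ : ∀ {a b r} {A : Set a} {B : Set b} {R : A → B → Set r} {xs ys x} →
  Pointwise R xs ys → x ∈ xs → ∃[ y ] (y ∈ ys × R x y)
Pointwise-∈ (r ∷ _) (here refl) = _ , here refl , r
Pointwise-∈ (_ ∷ rs) (there m) =
  let (y , y∈ys , r) = Pointwise-∈ rs m in y , there y∈ys , r

ProcRel : Set₁
ProcRel = Proc → Proc → Set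

BranchBisim : ProcRel → List (Label × Proc) → List (Label × Proc) → Set
BranchBisim R Λ Λ' =
  (∀ {ℓ P} → (ℓ , P) ∈ Λ  → ∃[ Q ] ((ℓ , Q) ∈ Λ' × R P Q)) ×
  (∀ {ℓ Q} → (ℓ , Q) ∈ Λ' → ∃[ P ] ((ℓ , P) ∈ Λ  × R P Q))

branchBisim-mono : ∀ {R R' : ProcRel} → (∀ {a b} → R a b → R' a b) →
  ∀ {Λ Λ'} → BranchBisim R Λ Λ' → BranchBisim R' Λ Λ'
branchBisim-mono f (fw , bw) =
  (λ m → let (Q , m' , r) = fw m in Q , m' , f r) ,
  (λ m → let (P , m' , r) = bw m in P , m' , f r)

bisimStep-mono : ∀ {R R' : ProcRel} → (∀ {a b} → R a b → R' a b) →
  ∀ x y → BisimStepP R x y → BisimStepP R' x y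
bisimStep-mono f nil       nil       _       = tt
bisimStep-mono f (inp _ _) (inp _ _) (e , b) = e , branchBisim-mono f b
bisimStep-mono f (out _ _) (out _ _) (e , b) = e , branchBisim-mono f b
bisimStep-mono f nil       (inp _ _) ()
bisimStep-mono f nil       (out _ _) ()
bisimStep-mono f (inp _ _) nil       ()
bisimStep-mono f (inp _ _) (out _ _) ()
bisimStep-mono f (out _ _) nil       ()
bisimStep-mono f (out _ _) (inp _ _) ()

bisimStep-sym : ∀ {R : ProcRel} x y → BisimStepP R x y → BisimStepP (λ a b → R b a) y x
bisimStep-sym nil       nil       _              = tt
bisimStep-sym (inp _ _) (inp _ _) (e , fw , bw) = sym e , bw , fw
bisimStep-sym (out _ _) (out _ _) (e , fw , bw) = sym e , bw , fw
bisimStep-sym nil       (inp _ _) ()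
bisimStep-sym nil       (out _ _) ()
bisimStep-sym (inp _ _) nil       ()
bisimStep-sym (inp _ _) (out _ _) ()
bisimStep-sym (out _ _) nil       ()
bisimStep-sym (out _ _) (inp _ _) ()

bisimStep-refl : ∀ x → BisimStepP _≡_ x x
bisimStep-refl nil       = tt
bisimStep-refl (inp _ _) = refl , (λ m → _ , m , refl) , (λ m → _ , m , refl)
bisimStep-refl (out _ _) = refl , (λ m → _ , m , refl) , (λ m → _ , m , refl)

≈P-sym : ∀ {P Q} → P ≈P Q → Q ≈P P
≈P-sym (S , S-step , s) = (λ a b → S b a) , (λ {a} {b} s' → bisimStep-sym (viewP b) (viewP a) (S-step s')) , s

compatStep-mono : ∀ {R R' : ProcRel} → (∀ {a b} → R a b → R' a b) →
  ∀ x y → CompatStep R x y → CompatStep R' x y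
compatStep-mono f nil       nil       _ = tt
compatStep-mono f (out _ _) (inp _ _) c = λ m → let (P , m' , r) = c m in P , m' , f r
compatStep-mono f (inp _ _) (out _ _) c = λ m → let (P , m' , r) = c m in P , m' , f r
compatStep-mono f nil       (inp _ _) ()
compatStep-mono f nil       (out _ _) ()
compatStep-mono f (inp _ _) nil       ()
compatStep-mono f (inp _ _) (inp _ _) ()
compatStep-mono f (out _ _) nil       ()
compatStep-mono f (out _ _) (out _ _) ()

UpTo : ProcRel → ProcRel → ProcRel
UpTo E R a b = ∃[ a₀ ] ∃[ b₀ ] (R a₀ b₀ × E a₀ a × E b₀ b)

outIn-upTo : ∀ {E R Λo Λi Λo' Λi'} → OutIn R Λo Λi →
  BranchBisim E (toList Λo) (toList Λo') → BranchBisim E (toList Λi) (toList Λi') →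
  OutIn (UpTo E R) Λo' Λi'
outIn-upTo c (fwo , _) (_ , bwi) m =
  let (Q₀ , m₀ , eQ) = bwi m
      (P₀ , mP₀ , r) = c m₀
      (P , mP , eP)  = fwo mP₀
  in P , mP , P₀ , Q₀ , r , eP , eQ

compatStep-upTo : ∀ {E R} x₀ y₀ x y → CompatStep R x₀ y₀ →
  BisimStepP E x₀ x → BisimStepP E y₀ y → CompatStep (UpTo E R) x y
compatStep-upTo nil       nil       nil       nil       _ _        _        = tt
compatStep-upTo (out _ _) (inp _ _) (out _ _) (inp _ _) c (_ , bx) (_ , by) = outIn-upTo c bx by
compatStep-upTo (inp _ _) (out _ _) (inp _ _) (out _ _) c (_ , bx) (_ , by) = outIn-upTo c by bx
compatStep-upTo nil       nil       (inp _ _) _         _ ()       _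
compatStep-upTo nil       nil       (out _ _) _         _ ()       _
compatStep-upTo nil       nil       nil       (inp _ _) _ _        ()
compatStep-upTo nil       nil       nil       (out _ _) _ _        ()
compatStep-upTo (out _ _) (inp _ _) nil       _         _ ()       _
compatStep-upTo (out _ _) (inp _ _) (inp _ _) _         _ ()       _
compatStep-upTo (out _ _) (inp _ _) (out _ _) nil       _ _        ()
compatStep-upTo (out _ _) (inp _ _) (out _ _) (out _ _) _ _        ()
compatStep-upTo (inp _ _) (out _ _) nil       _         _ ()       _
compatStep-upTo (inp _ _) (out _ _) (out _ _) _         _ ()       _
compatStep-upTo (inp _ _) (out _ _) (inp _ _) nil       _ _        ()
compatStep-upTo (inp _ _) (out _ _) (inp _ _) (inp _ _) _ _        ()
compatStep-upTo nil       (inp _ _) _         _         () _       _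
compatStep-upTo nil       (out _ _) _         _         () _       _
compatStep-upTo (inp _ _) nil       _         _         () _       _
compatStep-upTo (inp _ _) (inp _ _) _         _         () _       _
compatStep-upTo (out _ _) nil       _         _         () _       _
compatStep-upTo (out _ _) (out _ _) _         _         () _       _

↔-sym : ∀ {P Q} → P ↔ Q → Q ↔ P
↔-sym (R , R-sym , R-step , r) = R , R-sym , R-step , R-sym r

↔-respʳ-≈P : ∀ {A B B'} → A ↔ B → B ≈P B' → A ↔ B'
↔-respʳ-≈P {A} {B} (R , R-sym , R-step , r) (S , S-step , s) =
  UpTo E R , R'-sym , R'-step , A , B , r , inj₁ refl , inj₂ s
  where
  E : ProcRel
  E a b = a ≡ b ⊎ S a b

  E-step : ∀ {a b} → E a b → BisimStepP E (viewP a) (viewP b)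
  E-step {a} (inj₁ refl) = bisimStep-mono inj₁ (viewP a) (viewP a) (bisimStep-refl (viewP a))
  E-step     (inj₂ s')   = bisimStep-mono inj₂ _ _ (S-step s')

  R'-sym : ∀ {a b} → UpTo E R a b → UpTo E R b a
  R'-sym (a₀ , b₀ , r' , ea , eb) = b₀ , a₀ , R-sym r' , eb , ea

  R'-step : ∀ {a b} → UpTo E R a b → CompatStep (UpTo E R) (viewP a) (viewP b)
  R'-step (_ , _ , r' , ea , eb) = compatStep-upTo _ _ _ _ (R-step r') (E-step ea) (E-step eb)

OutIn↔ : List⁺ (Label × Proc) → List⁺ (Label × Proc) → Set₁
OutIn↔ Λo Λi = ∀ {ℓ Q} → (ℓ , Q) ∈ toList Λi → ∃[ P ] ((ℓ , P) ∈ toList Λo × P ↔ Q)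

-- The witness relation is the pair itself together with the witnesses of all
-- the branches.
↔-out-inp⁺ : ∀ {A B q p Λo Λi} → viewP A ≡ out q Λo → viewP B ≡ inp p Λi →
  OutIn↔ Λo Λi → A ↔ B
↔-out-inp⁺ {A} {B} {Λo = Λo} {Λi} eA eB match = R , R-sym , R-step , inj₁ (inj₁ (refl , refl))
  where
  Branch : Set
  Branch = Σ Label λ ℓ → Σ Proc λ Q → (ℓ , Q) ∈ toList Λi

  compat : (β : Branch) → proj₁ (match (proj₂ (proj₂ β))) ↔ proj₁ (proj₂ β)
  compat (_ , _ , m) = proj₂ (proj₂ (match m))

  R : ProcRel
  R a b = ((a ≡ A × b ≡ B) ⊎ (a ≡ B × b ≡ A)) ⊎ Σ Branch λ β → proj₁ (compat β) a b

  R-sym : ∀ {a b} → R a b → R b a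
  R-sym (inj₁ (inj₁ (ea , eb))) = inj₁ (inj₂ (eb , ea))
  R-sym (inj₁ (inj₂ (ea , eb))) = inj₁ (inj₁ (eb , ea))
  R-sym (inj₂ (β , r))          = let (_ , S-sym , _) = compat β in inj₂ (β , S-sym r)

  root : OutIn R Λo Λi
  root m = let (P , mP , (_ , _ , _ , r)) = match m in P , mP , inj₂ ((_ , _ , m) , r)

  R-step : ∀ {a b} → R a b → CompatStep R (viewP a) (viewP b)
  R-step (inj₁ (inj₁ (refl , refl))) = subst₂ (CompatStep R) (sym eA) (sym eB) root
  R-step (inj₁ (inj₂ (refl , refl))) = subst₂ (CompatStep R) (sym eB) (sym eA) root
  R-step (inj₂ (β , r)) =
    let (_ , _ , S-step , _) = compat β in compatStep-mono (λ r' → inj₂ (β , r')) _ _ (S-step r)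

↔-inp⁻ : ∀ {A B p Λi} → A ↔ B → viewP B ≡ inp p Λi →
  ∃[ q ] ∃[ Λo ] (viewP A ≡ out q Λo × OutIn↔ Λo Λi)
↔-inp⁻ {A} (R , R-sym , R-step , r) eB
  with viewP A | subst (CompatStep R (viewP A)) eB (R-step r)
... | out q Λo | c = q , Λo , refl , λ m → let (P , mP , r') = c m in P , mP , R , R-sym , R-step , r'
... | nil      | ()
... | inp _ _  | ()

↔-inp-merge : ∀ {A B Bᵢ s Λ Λᵢ} → A ↔ B → viewP B ≡ inp s Λ → viewP Bᵢ ≡ inp s Λᵢ →
  (∀ {ℓ Q} → (ℓ , Q) ∈ toList Λᵢ → ∃[ P ] ((ℓ , P) ∈ toList Λ × P ≈P Q)) → A ↔ Bᵢ
↔-inp-merge A↔B eB eBᵢ included =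
  let (_ , _ , eA , match) = ↔-inp⁻ A↔B eB
  in ↔-out-inp⁺ eA eBᵢ λ m →
       let (Q₀ , mQ₀ , Q₀≈Q) = included m
           (P , mP , P↔Q₀)   = match mQ₀
       in P , mP , ↔-respʳ-≈P P↔Q₀ Q₀≈Q

-- inp1 adds a fresh root in front of the graph of P, so its continuation is
-- P with every node index shifted by one.
data Shifted : ProcRel where
  shifted : ∀ g p ℓ v i → Shifted ⟨ g , i ⟩ₚ ⟨ pgraph (inp1 p ℓ ⟨ g , v ⟩ₚ) , Fin.suc i ⟩ₚ

shifted-branches : ∀ g p ℓ v (Λ : List (Label × Fin (psize g))) →
  BranchBisim Shifted (List.map (map₂ (λ j → ⟨ g , j ⟩ₚ)) Λ)
    (List.map (map₂ (λ j → ⟨ pgraph (inp1 p ℓ ⟨ g , v ⟩ₚ) , j ⟩ₚ)) (List.map (map₂ Fin.suc) Λ))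
shifted-branches g p ℓ v Λ = fw , bw
  where
  g⁺ : PGraph
  g⁺ = pgraph (inp1 p ℓ ⟨ g , v ⟩ₚ)

  fw : ∀ {ℓ' P} → (ℓ' , P) ∈ List.map (map₂ (λ j → ⟨ g , j ⟩ₚ)) Λ →
       ∃[ Q ] ((ℓ' , Q) ∈ List.map (map₂ (λ j → ⟨ g⁺ , j ⟩ₚ)) (List.map (map₂ Fin.suc) Λ) × Shifted P Q)
  fw m with ∈-map⁻ _ m
  ... | (_ , j) , mj , refl = _ , ∈-map⁺ _ (∈-map⁺ _ mj) , shifted g p ℓ v j

  bw : ∀ {ℓ' Q} → (ℓ' , Q) ∈ List.map (map₂ (λ j → ⟨ g⁺ , j ⟩ₚ)) (List.map (map₂ Fin.suc) Λ) →
       ∃[ P ] ((ℓ' , P) ∈ List.map (map₂ (λ j → ⟨ g , j ⟩ₚ)) Λ × Shifted P Q)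
  bw m with ∈-map⁻ _ m
  ... | _ , ma , refl with ∈-map⁻ _ ma
  ... | (_ , j) , mj , refl = _ , ∈-map⁺ _ mj , shifted g p ℓ v j

shifted-step : ∀ {a b} → Shifted a b → BisimStepP Shifted (viewP a) (viewP b)
shifted-step (shifted g p ℓ v i) with pnode g i
... | nil     = tt
... | inp _ Λ = refl , shifted-branches g p ℓ v (toList Λ)
... | out _ Λ = refl , shifted-branches g p ℓ v (toList Λ)

inp1-unfold : ∀ p ℓ Q → ∃[ Q⁺ ] (viewP (inp1 p ℓ Q) ≡ inp p [ ℓ , Q⁺ ] × Q ≈P Q⁺)
inp1-unfold p ℓ ⟨ g , v ⟩ₚ = _ , refl , Shifted , shifted-step , shifted g p ℓ v v

↔-inp-prune : ∀ {P P' p ℓ Λ Pᵢ} → P ↔ P' → viewP P ≡ inp p Λ → (ℓ , Pᵢ) ∈ toList Λ →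
  inp1 p ℓ Pᵢ ↔ P'
↔-inp-prune {p = p} {ℓ} {Pᵢ = Pᵢ} P↔P' eP mPᵢ =
  let (_ , _ , eP' , match) = ↔-inp⁻ (↔-sym P↔P') eP
      (P₁ , mP₁ , P₁↔Pᵢ)    = match mPᵢ
      (Pᵢ⁺ , eI , Pᵢ≈Pᵢ⁺)   = inp1-unfold p ℓ Pᵢ
  in ↔-sym (↔-out-inp⁺ eP' eI λ { (here refl) → P₁ , mP₁ , ↔-respʳ-≈P P₁↔Pᵢ Pᵢ≈Pᵢ⁺ })

inp1-↔-out⁻ : ∀ {p ℓ Q P' s Λ} → inp1 p ℓ Q ↔ P' → viewP P' ≡ out s Λ →
  ∃[ P₁ ] ((ℓ , P₁) ∈ toList Λ × Q ↔ P₁)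
inp1-↔-out⁻ {p} {ℓ} {Q} I↔P' eP' with inp1-unfold p ℓ Q
... | Q⁺ , eI , Q≈Q⁺ with ↔-inp⁻ (↔-sym I↔P') eI
... | _ , _ , eP'' , match with trans (sym eP') eP''
... | refl = let (P₁ , mP₁ , P₁↔Q⁺) = match (here refl)
             in P₁ , mP₁ , ↔-sym (↔-respʳ-≈P P₁↔Q⁺ (≈P-sym Q≈Q⁺))

distinctMsgs-cont : ∀ {G q r bs ℓ Gᵢ} → DistinctMsgs G → view G ≡ msg q r bs →
  (ℓ , Gᵢ) ∈ toList bs → DistinctMsgs Gᵢ
distinctMsgs-cont d eG m H s = d H (sub-step eG m s)

proj-absent : ∀ {G p P} → ¬ (p ∈pt G) → viewP P ≡ nil → Proj G p P
proj-absent p∉G eP = (λ G p P → ¬ (p ∈pt G) × viewP P ≡ nil) , (λ (p∉ , e) → proj-none p∉ e) , p∉G , eP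

-- ProjStep at a communication q → r, with the view equation of G solved.
data ProjStepAt (Rp : PRel) (G : Global) (h : Role) (P : Proc) :
                Role → Role → List⁺ (Label × Global) → Set₁ where
  at-none  : ∀ {q r bs} → ¬ (h ∈pt G) → viewP P ≡ nil → ProjStepAt Rp G h P q r bs
  at-send  : ∀ {q bs Λ} → viewP P ≡ out q Λ → BranchProj Rp h bs Λ → ProjStepAt Rp G h P h q bs
  at-recv  : ∀ {q bs Λ} → viewP P ≡ inp q Λ → BranchProj Rp h bs Λ → ProjStepAt Rp G h P q h bs
  at-same  : ∀ {q r bs} → h ≢ q → h ≢ r → All.All (λ b → Rp (proj₂ b) h P) (toList bs) →
             ProjStepAt Rp G h P q r bs
  at-merge : ∀ {q r bs s Λ Λs} → h ≢ q → h ≢ r →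
             viewP P ≡ inp s Λ →
             Pointwise (λ b Λᵢ → ∃[ Pᵢ ] (Rp (proj₂ b) h Pᵢ × viewP Pᵢ ≡ inp s Λᵢ)) (toList bs) Λs →
             toList Λ ≈Λ List.concatMap toList Λs → ProjStepAt Rp G h P q r bs

projStepAt : ∀ {Rp G h P q r bs} → view G ≡ msg q r bs → ProjStep Rp G h P → ProjStepAt Rp G h P q r bs
projStepAt eG (proj-none h∉G eP) = at-none h∉G eP
projStepAt eG (proj-send eG' eP bp) with trans (sym eG) eG'
... | refl = at-send eP bp
projStepAt eG (proj-recv eG' eP bp) with trans (sym eG) eG'
... | refl = at-recv eP bp
projStepAt eG (proj-same _ eG' h≢q h≢r all) with trans (sym eG) eG'
... | refl = at-same h≢q h≢r all
projStepAt eG (proj-merge Λs _ eG' h≢q h≢r eP pw _ eqΛ) with trans (sym eG) eG'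
... | refl = at-merge h≢q h≢r eP pw eqΛ

proj-recv-branch : ∀ {G h P p bs} → Proj G h P → view G ≡ msg p h bs → p ≢ h →
  ∃[ Λ ] (viewP P ≡ inp p Λ ×
          (∀ {ℓ Gᵢ} → (ℓ , Gᵢ) ∈ toList bs → ∃[ Pᵢ ] ((ℓ , Pᵢ) ∈ toList Λ × Proj Gᵢ h Pᵢ)))
proj-recv-branch (Rp , closed , r) eG p≢h with projStepAt eG (closed r)
... | at-none h∉G _              = ⊥-elim (h∉G (here eG (inj₂ refl)))
... | at-send _ _                = ⊥-elim (p≢h refl)
... | at-recv eP (fw , _)        =
  _ , eP , λ m → let (Pᵢ , mPᵢ , rᵢ) = fw m in Pᵢ , mPᵢ , Rp , closed , rᵢ
... | at-same _ h≢h _            = ⊥-elim (h≢h refl)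
... | at-merge _ h≢h _ _ _       = ⊥-elim (h≢h refl)

proj-send-branch : ∀ {G h P s bs} → DistinctMsgs G → Proj G h P → view G ≡ msg h s bs → s ≢ h →
  ∃[ Λ ] (viewP P ≡ out s Λ ×
          (∀ {ℓ Pᵢ Gᵢ} → (ℓ , Pᵢ) ∈ toList Λ → (ℓ , Gᵢ) ∈ toList bs → Proj Gᵢ h Pᵢ))
proj-send-branch {G} {h} {bs = bs} d (Rp , closed , r) eG s≢h with projStepAt eG (closed r)
... | at-none h∉G _              = ⊥-elim (h∉G (here eG (inj₁ refl)))
... | at-send {Λ = Λ} eP (_ , bw) = _ , eP , branch
  where
  branch : ∀ {ℓ Pᵢ Gᵢ} → (ℓ , Pᵢ) ∈ toList Λ → (ℓ , Gᵢ) ∈ toList bs → Proj Gᵢ h Pᵢ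
  branch mPᵢ mGᵢ =
    let (_ , mG , rᵢ) = bw mPᵢ
    in subst (λ Gᵢ → Proj Gᵢ h _) (unique-keys-functional (d G sub-refl eG) mG mGᵢ) (Rp , closed , rᵢ)
... | at-recv _ _                = ⊥-elim (s≢h refl)
... | at-same h≢h _ _            = ⊥-elim (h≢h refl)
... | at-merge h≢h _ _ _ _       = ⊥-elim (h≢h refl)

-- The projection of a branch on an uninvolved participant is either the whole
-- projection or one of the inputs merged into it.
proj-other-branch : ∀ {G h P q r bs ℓ Gᵢ} → Proj G h P → view G ≡ msg q r bs → q ≢ h → r ≢ h →
  (ℓ , Gᵢ) ∈ toList bs → ∃[ Pᵢ ] (Proj Gᵢ h Pᵢ × (∀ {A} → A ↔ P → A ↔ Pᵢ))
proj-other-branch (Rp , closed , r) eG q≢h r≢h m with projStepAt eG (closed r)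
... | at-none h∉G eP        = _ , proj-absent (λ h∈Gᵢ → h∉G (there eG m h∈Gᵢ)) eP , λ c → c
... | at-send _ _           = ⊥-elim (q≢h refl)
... | at-recv _ _           = ⊥-elim (r≢h refl)
... | at-same _ _ all       = _ , (Rp , closed , All.lookup all m) , λ c → c
... | at-merge _ _ eP pw (_ , bw) =
  let (Λᵢ , mΛᵢ , Pᵢ , rᵢ , ePᵢ) = Pointwise-∈ pw m
  in Pᵢ , (Rp , closed , rᵢ) ,
     λ c → ↔-inp-merge c eP ePᵢ (λ mQ → bw (∈-concat⁺′ mQ (∈-map⁺ toList mΛᵢ)))

DistinctCall : Call → Set
DistinctCall c = DistinctMsgs (Y c) × DistinctMsgs (Y' c)

child-distinct : ∀ {c c'} → Child c c' → DistinctCall c → DistinctCall c'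
child-distinct (cl2 eG _ m)                 (d , d') = distinctMsgs-cont d eG m , d'
child-distinct (cl3 eG' _ m)                (d , d') = d , distinctMsgs-cont d' eG' m
child-distinct (cl4 eG' _ _ m)              (d , d') = d , distinctMsgs-cont d' eG' m
child-distinct (cl5 _ _ eG' _ m)            (d , d') = d , distinctMsgs-cont d' eG' m
child-distinct (cl6 eG _ m)                 (d , d') = distinctMsgs-cont d eG m , d'
child-distinct (cl7 eG _ _ m)               (d , d') = distinctMsgs-cont d eG m , d'
child-distinct (cl8 _ eG _ _ m)             (d , d') = d' , distinctMsgs-cont d eG m
child-distinct (cl9 _ _ _ _ eG' _ _ m)      (d , d') = distinctMsgs-cont d' eG' m , d

child-invariant : ∀ {c c'} → Child c c' → DistinctCall c → Invariant c → Invariant c'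
child-invariant (cl2 eG (p≢h , _) m) _ (P , P' , prj , prj' , P↔P') =
  let (_ , eP , branch)  = proj-recv-branch prj eG p≢h
      (Pᵢ , mPᵢ , prjᵢ) = branch m
  in _ , Pᵢ , P' , prjᵢ , prj' , ↔-inp-prune P↔P' eP mPᵢ
child-invariant (cl3 eG' (_ , s≢k) m) (_ , d') (_ , P , P' , prj , prj' , I↔P') =
  let (_ , eP' , branch) = proj-send-branch d' prj' eG' s≢k
      (P₁ , mP₁ , P↔P₁) = inp1-↔-out⁻ I↔P' eP'
  in P , P₁ , prj , branch mP₁ m , P↔P₁
child-invariant (cl4 eG' (_ , r≢k) (_ , s≢k) m) _ (p , P , P' , prj , prj' , I↔P') =
  let (P'ⱼ , prjⱼ , keep) = proj-other-branch prj' eG' r≢k s≢k m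
  in p , P , P'ⱼ , prj , prjⱼ , keep I↔P'
child-invariant (cl5 _ _ eG' (_ , r≢k) m) _ (P , P' , prj , prj' , P↔P') =
  let (_ , eP' , branch)  = proj-recv-branch prj' eG' r≢k
      (P'ⱼ , mP'ⱼ , prjⱼ) = branch m
  in _ , P , P'ⱼ , prj , prjⱼ , ↔-sym (↔-inp-prune (↔-sym P↔P') eP' mP'ⱼ)
child-invariant (cl6 eG (q≢h , _) m) (d , _) (_ , P , P' , prj , prj' , P↔I) =
  let (_ , eP , branch)   = proj-send-branch d prj eG q≢h
      (P₁ , mP₁ , P'↔P₁) = inp1-↔-out⁻ (↔-sym P↔I) eP
  in P₁ , P' , branch mP₁ m , prj' , ↔-sym P'↔P₁
child-invariant (cl7 eG (p≢h , _) (q≢h , _) m) _ (p , P , P' , prj , prj' , P↔I) =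
  let (Pᵢ , prjᵢ , keep) = proj-other-branch prj eG p≢h q≢h m
  in p , Pᵢ , P' , prjᵢ , prj' , ↔-sym (keep (↔-sym P↔I))
child-invariant (cl8 _ eG (p≢h , _) (q≢h , _) m) _ (P , P' , prj , prj' , P↔P') =
  let (Pᵢ , prjᵢ , keep) = proj-other-branch prj eG p≢h q≢h m
  in P' , Pᵢ , prj' , prjᵢ , keep (↔-sym P↔P')
child-invariant (cl9 _ _ _ _ eG' (_ , r≢k) (_ , s≢k) m) _ (P , P' , prj , prj' , P↔P') =
  let (P'ⱼ , prjⱼ , keep) = proj-other-branch prj' eG' r≢k s≢k m
  in P'ⱼ , P , prjⱼ , prj , ↔-sym (keep P↔P')

callTree-invariant : ∀ {c c'} → InCallTree c c' → DistinctCall c → Invariant c → Invariant c'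
callTree-invariant ε         _ inv = inv
callTree-invariant (s ◅ ss) d inv = callTree-invariant ss (child-distinct s d) (child-invariant s d inv)

mainTheorem13 : (G G' : Global) (h k : Role) →
    WellFormed G → WellFormed G' →
    (∀ p → p ∈pt G → p ∈pt G' → ⊥) →
    (∃[ P ] ∃[ P' ] (Proj G h P × Proj G' k P' × P ↔ P')) →
    ∀ c → InCallTree (cn h k # G G') c → Invariant c
mainTheorem13 G G' h k (distinct , _) (distinct' , _) _ inv c path =
  callTree-invariant path (distinct , distinct') inv
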